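{- For every integer $n\ge 1$, the clique complex $K_n$ of the partition graph $G_n$ is simply connected.
   Context: A partition of a positive integer $n$ is a weakly decreasing sequence $\lambda=(\lambda_1\ge\cdots\ge\lambda_\ell>0)$ of positive integers with sum $n$; it is identified with its Ferrers diagram, the left-justified array with $\lambda_i$ cells in row $i$. The partition graph $G_n$ is the simple graph whose vertices are all partitions of $n$; two distinct partitions are adjacent if one can be obtained from the other by removing one cell from a row of the Ferrers diagram, adding it to another row (possibly a new row, i.e. a row of length $0$), and then reordering the row lengths into weakly decreasing order (discarding zeros). $K_n:=\mathrm{Cl}(G_n)$ is the clique complex of $G_n$: the simplicial complex whose simplices are the finite nonempty cliques of $G_n$. -}

module Defs where

open import Algebra.Bundles using (Group)
open import Data.List using (List; []; _∷_; _∷ʳ_; filter)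
open import Data.List.Membership.Propositional using (_∈_)
open import Data.List.Relation.Binary.Permutation.Propositional using (_↭_)
open import Data.List.Relation.Binary.Subset.Propositional using (_⊆_)
open import Data.List.Relation.Unary.All as All using (All)
open import Data.List.Relation.Unary.Any using (here; there)
open import Data.List.Relation.Unary.Linked as Linked using (Linked)
open import Data.Nat using (ℕ; suc; _≥_; _<_; _<?_)
open import Data.Nat.ListAction using (sum)
open import Data.Nat.Properties using (≤-irrelevant; ≡-irrelevant)
open import Data.Product using (_×_; _,_; ∃-syntax)
open import Data.Sum using (_⊎_; swap)
open import Level using (0ℓ)
open import Relation.Binary.Construct.Closure.ReflexiveTransitive
  using (Star; ε; _◅_; _◅◅_; reverse; revApp)
open import Relation.Binary.Construct.Closure.ReflexiveTransitive.Properties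
  using (◅◅-assoc)
open import Relation.Binary.PropositionalEquality
  using (_≡_; _≢_; refl; sym; cong)
open import Relation.Nullary using (¬_; contradiction)

record SimpleGraph : Set₁ where
  field
    Vertex   : Set
    Adj      : Vertex → Vertex → Set
    adj-sym  : ∀ {u v} → Adj u v → Adj v u
    loopless : ∀ {v} → ¬ Adj v v

-- A finite set of vertices is represented by any list enumerating it:
-- order and repetitions are irrelevant, since `face` makes `Simplex`
-- depend only on the set of members of the list.
record SimplicialComplex : Set₁ where
  field
    Vertex   : Set
    Simplex  : List Vertex → Set
    nonempty : ¬ Simplex []
    point    : ∀ v → Simplex (v ∷ [])
    face     : ∀ {σ τ} → Simplex σ → τ ≢ [] → τ ⊆ σ → Simplex τ

module _ (G : SimpleGraph) where
  open SimpleGraph G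

  record IsClique (σ : List Vertex) : Set where
    field
      nonempty : σ ≢ []
      adjacent : ∀ {u v} → u ∈ σ → v ∈ σ → u ≢ v → Adj u v

  cliqueComplex : SimplicialComplex
  cliqueComplex = record
    { Vertex   = Vertex
    ; Simplex  = IsClique
    ; nonempty = λ c → IsClique.nonempty c refl
    ; point    = λ v → record
      { nonempty = λ ()
      ; adjacent = λ { (here refl) (here refl) v≢v → contradiction refl v≢v }
      }
    ; face     = λ c τ≢[] τ⊆σ → record
      { nonempty = τ≢[]
      ; adjacent = λ u∈τ v∈τ → IsClique.adjacent c (τ⊆σ u∈τ) (τ⊆σ v∈τ)
      }
    }

IsTrivial : Group 0ℓ 0ℓ → Set
IsTrivial Γ = ∀ x → x ≈ 1#
  where open Group Γ using (_≈_) renaming (ε to 1#)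

-- The fundamental group of a simplicial complex is taken to be its
-- edge-path group, which is canonically isomorphic to the fundamental
-- group of the geometric realization.

module _ (K : SimplicialComplex) where
  open SimplicialComplex K

  -- Degenerate edges (u = v) are allowed.
  Edge : Vertex → Vertex → Set
  Edge u v = Simplex (u ∷ v ∷ [])

  EdgePath : Vertex → Vertex → Set
  EdgePath = Star Edge

  -- Equivalence of edge paths with the same endpoints: the least
  -- congruence for concatenation under which a degenerate edge may be
  -- deleted, and two sides of a (possibly degenerate) triangle may be
  -- replaced by the third side.
  infix 4 _≃_
  data _≃_ : ∀ {u v} → EdgePath u v → EdgePath u v → Set where
    ≃-refl     : ∀ {u v} {p : EdgePath u v} → p ≃ p
    ≃-sym      : ∀ {u v} {p q : EdgePath u v} → p ≃ q → q ≃ p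
    ≃-trans    : ∀ {u v} {p q r : EdgePath u v} → p ≃ q → q ≃ r → p ≃ r
    ◅◅-cong    : ∀ {u v w} {p p′ : EdgePath u v} {q q′ : EdgePath v w} →
                 p ≃ p′ → q ≃ q′ → p ◅◅ q ≃ p′ ◅◅ q′
    degenerate : ∀ {v} (e : Edge v v) → e ◅ ε ≃ ε
    triangle   : ∀ {u v w} (e : Edge u v) (f : Edge v w) (g : Edge u w) →
                 Simplex (u ∷ v ∷ w ∷ []) → e ◅ f ◅ ε ≃ g ◅ ε

  reverseEdge : ∀ {u v} → Edge u v → Edge v u
  reverseEdge e = face e (λ ()) λ
    { (here refl)         → there (here refl)
    ; (there (here refl)) → here refl
    }

  reversePath : ∀ {u v} → EdgePath u v → EdgePath v u
  reversePath = reverse reverseEdge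

  private
    ≡⇒≃ : ∀ {u v} {p q : EdgePath u v} → p ≡ q → p ≃ q
    ≡⇒≃ refl = ≃-refl

    ◅◅-identityʳ : ∀ {u v} (p : EdgePath u v) → p ◅◅ ε ≡ p
    ◅◅-identityʳ ε       = refl
    ◅◅-identityʳ (e ◅ p) = cong (e ◅_) (◅◅-identityʳ p)

    revApp-◅◅ : ∀ {u v w x} (p : EdgePath v u) (q : EdgePath v w)
                (r : EdgePath w x) →
                revApp reverseEdge p (q ◅◅ r) ≡ revApp reverseEdge p q ◅◅ r
    revApp-◅◅ ε       q r = refl
    revApp-◅◅ (e ◅ p) q r = revApp-◅◅ p (reverseEdge e ◅ q) r

    revApp-of-◅◅ : ∀ {u v w x} (p : EdgePath u v) (q : EdgePath v w)
                   (r : EdgePath u x) →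
                   revApp reverseEdge (p ◅◅ q) r ≡
                   revApp reverseEdge q (revApp reverseEdge p r)
    revApp-of-◅◅ ε       q r = refl
    revApp-of-◅◅ (e ◅ p) q r = revApp-of-◅◅ p q (reverseEdge e ◅ r)

    reverse-◅◅ : ∀ {u v w} (p : EdgePath u v) (q : EdgePath v w) →
                 reversePath (p ◅◅ q) ≃ reversePath q ◅◅ reversePath p
    reverse-◅◅ p q = ≃-trans (≡⇒≃ (revApp-of-◅◅ p q ε))
                             (≡⇒≃ (revApp-◅◅ q ε (reversePath p)))

    reverseTriangle : ∀ {u v w} → Simplex (u ∷ v ∷ w ∷ []) →
                      Simplex (w ∷ v ∷ u ∷ [])
    reverseTriangle t = face t (λ ()) λ
      { (here refl)                 → there (there (here refl))
      ; (there (here refl))         → there (here refl)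
      ; (there (there (here refl))) → here refl
      }

    backtrack : ∀ {u v} (e : Edge u v) → e ◅ reverseEdge e ◅ ε ≃ ε
    backtrack {u} {v} e =
      ≃-trans (triangle e (reverseEdge e) loop there-and-back) (degenerate loop)
      where
      loop : Edge u u
      loop = face e (λ ()) λ
        { (here refl) → here refl ; (there (here refl)) → here refl }

      there-and-back : Simplex (u ∷ v ∷ u ∷ [])
      there-and-back = face e (λ ()) λ
        { (here refl)                 → here refl
        ; (there (here refl))         → there (here refl)
        ; (there (there (here refl))) → here refl
        }

    backtrack′ : ∀ {u v} (e : Edge u v) → reverseEdge e ◅ e ◅ ε ≃ ε
    backtrack′ {u} {v} e =
      ≃-trans (triangle (reverseEdge e) e loop there-and-back) (degenerate loop)
      where
      loop : Edge v v
      loop = face e (λ ()) λ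
        { (here refl)         → there (here refl)
        ; (there (here refl)) → there (here refl)
        }

      there-and-back : Simplex (v ∷ u ∷ v ∷ [])
      there-and-back = face e (λ ()) λ
        { (here refl)                 → there (here refl)
        ; (there (here refl))         → here refl
        ; (there (there (here refl))) → there (here refl)
        }

    reverse-∷ : ∀ {u v w} (e : Edge u v) (p : EdgePath v w) →
                reversePath (e ◅ p) ≡ reversePath p ◅◅ (reverseEdge e ◅ ε)
    reverse-∷ e p = revApp-◅◅ p ε (reverseEdge e ◅ ε)

    reverse-cong : ∀ {u v} {p q : EdgePath u v} →
                   p ≃ q → reversePath p ≃ reversePath q
    reverse-cong ≃-refl           = ≃-refl
    reverse-cong (≃-sym p≃q)      = ≃-sym (reverse-cong p≃q)
    reverse-cong (≃-trans p≃q q≃r) =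
      ≃-trans (reverse-cong p≃q) (reverse-cong q≃r)
    reverse-cong (◅◅-cong {p = p} {p′} {q} {q′} p≃p′ q≃q′) =
      ≃-trans (reverse-◅◅ p q)
        (≃-trans (◅◅-cong (reverse-cong q≃q′) (reverse-cong p≃p′))
                 (≃-sym (reverse-◅◅ p′ q′)))
    reverse-cong (degenerate e)   = degenerate (reverseEdge e)
    reverse-cong (triangle e f g t) =
      triangle (reverseEdge f) (reverseEdge e) (reverseEdge g)
               (reverseTriangle t)

    inverseʳ : ∀ {u v} (p : EdgePath u v) → p ◅◅ reversePath p ≃ ε
    inverseʳ ε       = ≃-refl
    inverseʳ (e ◅ p) =
      ≃-trans (≡⇒≃ (cong (λ r → e ◅ (p ◅◅ r)) (reverse-∷ e p)))
      (≃-trans (≡⇒≃ (cong (e ◅_)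
                 (sym (◅◅-assoc p (reversePath p) (reverseEdge e ◅ ε)))))
      (≃-trans (◅◅-cong (≃-refl {p = e ◅ ε})
                 (◅◅-cong (inverseʳ p) (≃-refl {p = reverseEdge e ◅ ε})))
               (backtrack e)))

    inverseˡ : ∀ {u v} (p : EdgePath u v) → reversePath p ◅◅ p ≃ ε
    inverseˡ ε       = ≃-refl
    inverseˡ (e ◅ p) =
      ≃-trans (≡⇒≃ (cong (_◅◅ (e ◅ p)) (reverse-∷ e p)))
      (≃-trans (≡⇒≃ (◅◅-assoc (reversePath p) (reverseEdge e ◅ ε) (e ◅ p)))
      (≃-trans (◅◅-cong (≃-refl {p = reversePath p})
                 (◅◅-cong (backtrack′ e) (≃-refl {p = p})))
               (inverseˡ p)))

  edgePathGroup : Vertex → Group 0ℓ 0ℓ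
  edgePathGroup v = record
    { Carrier = EdgePath v v
    ; _≈_     = _≃_
    ; _∙_     = _◅◅_
    ; ε       = ε
    ; _⁻¹     = reversePath
    ; isGroup = record
      { isMonoid = record
        { isSemigroup = record
          { isMagma = record
            { isEquivalence = record
              { refl = ≃-refl ; sym = ≃-sym ; trans = ≃-trans }
            ; ∙-cong = ◅◅-cong
            }
          ; assoc = λ p q r → ≡⇒≃ (◅◅-assoc p q r)
          }
        ; identity = (λ _ → ≃-refl) , λ p → ≡⇒≃ (◅◅-identityʳ p)
        }
      ; inverse = inverseˡ , inverseʳ
      ; ⁻¹-cong = reverse-cong
      }
    }

  record SimplyConnected : Set where
    field
      inhabited : Vertex
      connected : ∀ u v → EdgePath u v
      trivial   : ∀ v → IsTrivial (edgePathGroup v)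

record Partition (n : ℕ) : Set where
  constructor mkPartition
  field
    parts      : List ℕ
    decreasing : Linked _≥_ parts
    positive   : All (0 <_) parts
    sum≡n      : sum parts ≡ n

open Partition public

-- Hence `_≡_` on `Partition n` is equality of the sequences of parts.
parts-injective : ∀ {n} {α β : Partition n} → parts α ≡ parts β → α ≡ β
parts-injective {α = mkPartition xs d p s} {mkPartition .xs d′ p′ s′} refl
  with refl ← Linked.irrelevant ≤-irrelevant d d′
     | refl ← All.irrelevant ≤-irrelevant p p′
     | refl ← ≡-irrelevant s s′
  = refl

-- The row lengths of the diagram, followed by one empty row.
rows : ∀ {n} → Partition n → List ℕ
rows α = parts α ∷ʳ 0

-- One cell is moved from a row of length 1 + a to another row, of length
-- b (possibly the empty one); the remaining rows are unchanged.  Since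
-- `parts β` is weakly decreasing, being a permutation of the new nonzero
-- row lengths says that it is their decreasing rearrangement.
infix 4 _↝_
_↝_ : ∀ {n} → Partition n → Partition n → Set
α ↝ β = ∃[ a ] ∃[ b ] ∃[ others ]
  rows α ↭ suc a ∷ b ∷ others ×
  parts β ↭ filter (0 <?_) (a ∷ suc b ∷ others)

partitionGraph : ℕ → SimpleGraph
partitionGraph n = record
  { Vertex   = Partition n
  ; Adj      = λ α β → α ≢ β × (α ↝ β ⊎ β ↝ α)
  ; adj-sym  = λ (α≢β , move) → (λ β≡α → α≢β (sym β≡α)) , swap move
  ; loopless = λ (α≢α , _) → α≢α refl
  }

{-# OPTIONS --safe #-}

-- Orient each edge of the partition graph towards the larger sum of squares
-- of parts, i.e. in the direction in which a cell moves to a row at least as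
-- long as its own.  Every ascending path ends at (n), and the upper
-- neighbours of any vertex span a connected subgraph: moves with the same
-- source or the same target lead to adjacent partitions, and each move can be
-- redirected to the largest row.  By well-founded induction all ascending
-- paths from a vertex to (n) are homotopic, so following an edge and then
-- ascending is homotopic to ascending at once; hence every loop p at v
-- satisfies p · c ≃ c, for c an ascending path from v to (n).

module Submission where

import Algebra.Properties.Group as GroupProperties
open import Data.List using (List; []; _∷_; _∷ʳ_; _++_; filter; map)
open import Data.List.Membership.Propositional.Properties using (∈-∃++)
open import Data.List.Properties
  using (≡-dec; ++-identityʳ; filter-++; filter-all; filter-idem)
open import Data.List.Relation.Binary.Permutation.Propositional
  using (_↭_; ↭-refl; ↭-sym; ↭-trans; ↭-reflexive; prep; swap; ↭⇒↭ₛ)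
open import Data.List.Relation.Binary.Permutation.Propositional.Properties
  using (shift; drop-∷; filter-↭; map⁺; ++⁺ʳ; ↭-length; ∈-resp-↭; All-resp-↭)
open import Data.List.Relation.Binary.Pointwise using (Pointwise-≡⇒≡)
open import Data.List.Relation.Unary.All using (All; []; _∷_)
open import Data.List.Relation.Unary.All.Properties using (all-filter)
open import Data.List.Relation.Unary.AllPairs using (_∷_)
open import Data.List.Relation.Unary.Any using (here; there)
open import Data.List.Relation.Unary.Linked using (Linked; [-])
open import Data.List.Relation.Unary.Linked.Properties using (Linked⇒AllPairs)
open import Data.List.Relation.Unary.Sorted.TotalOrder.Properties using (↗↭↗⇒≋)
import Data.List.Sort as Sort
open import Data.Nat
  using
  (ℕ; zero; suc; _+_; _*_; _∸_; _≤_; _≥_; _<_; _<?_; s≤s⁻¹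
  ; compare; less; equal; greater)
open import Data.Nat.Induction using (<-wellFounded)
open import Data.Nat.ListAction using (sum)
open import Data.Nat.ListAction.Properties using (sum-↭)
open import Data.Nat.Properties
open import Data.Nat.Tactic.RingSolver using (solve-∀)
open import Data.Product using (_×_; _,_; ∃-syntax)
open import Data.Sum using (_⊎_; inj₁; inj₂) renaming (swap to swap⊎)
open import Defs
open import Function using (_∘_; flip)
open import Induction.WellFounded using (Acc; acc; WellFounded; module Subrelation)
open import Relation.Binary.Bundles using (DecTotalOrder)
open import Relation.Binary.Construct.Closure.ReflexiveTransitive as Star
  using (Star; ε; _◅_; _◅◅_)
open import Relation.Binary.Construct.Closure.ReflexiveTransitive.Properties
  using (◅◅-assoc)
import Relation.Binary.Construct.Flip.EqAndOrd as Flip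
import Relation.Binary.Construct.On as On
open import Relation.Binary.Definitions using (DecidableEquality)
open import Relation.Binary.PropositionalEquality
  using (_≡_; _≢_; refl; sym; trans; cong; subst; subst₂)
open import Relation.Nullary using (¬_; yes; no; contradiction)
open import Relation.Nullary.Decidable using (map′)

-- Edge paths in the clique complex of a graph.

module AscendingPaths
  (G : SimpleGraph) (_≟ᵥ_ : DecidableEquality (SimpleGraph.Vertex G))
  where

  open SimpleGraph G

  private
    K : SimplicialComplex
    K = cliqueComplex G

    infix 4 _≈_
    _≈_ : ∀ {u v} → EdgePath K u v → EdgePath K u v → Set
    _≈_ = _≃_ K

  -- Stated as an implication because edges of the complex may be degenerate: `Near` is what a
  -- two-vertex clique amounts to, without deciding whether u and v coincide.
  Near : Vertex → Vertex → Set
  Near u v = u ≢ v → Adj u v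

  edge : ∀ {u v} → Near u v → Edge K u v
  edge {u} {v} uv = record
    { nonempty = λ ()
    ; adjacent = λ
      { (here refl)         (here refl)         u≢u → contradiction refl u≢u
      ; (here refl)         (there (here refl)) u≢v → uv u≢v
      ; (there (here refl)) (here refl)         v≢u →
          adj-sym (uv (v≢u ∘ sym))
      ; (there (here refl)) (there (here refl)) v≢v → contradiction refl v≢v
      }
    }

  near : ∀ {u v} → Edge K u v → Near u v
  near e = IsClique.adjacent e (here refl) (there (here refl))

  -- In a clique complex every closed triangle of edges is filled, so the simplex demanded by
  -- `triangle` comes for free.
  compose : ∀ {u v w} (e : Edge K u v) (f : Edge K v w) (g : Edge K u w) →
            (e ◅ f ◅ ε) ≈ (g ◅ ε)
  compose e f g = triangle e f g record
    { nonempty = λ ()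
    ; adjacent = λ
      { (here refl) (here refl) x≢x → contradiction refl x≢x
      ; (here refl) (there (here refl)) → near e
      ; (here refl) (there (there (here refl))) → near g
      ; (there (here refl)) (here refl) → near (reverseEdge K e)
      ; (there (here refl)) (there (here refl)) x≢x → contradiction refl x≢x
      ; (there (here refl)) (there (there (here refl))) → near f
      ; (there (there (here refl))) (here refl) → near (reverseEdge K g)
      ; (there (there (here refl))) (there (here refl)) →
          near (reverseEdge K f)
      ; (there (there (here refl))) (there (there (here refl))) x≢x →
          contradiction refl x≢x
      }
    }

  ◅-congʳ : ∀ {u v w} (e : Edge K u v) {p q : EdgePath K v w} →
            p ≈ q → (e ◅ p) ≈ (e ◅ q)
  ◅-congʳ e = ◅◅-cong (≃-refl {p = e ◅ ε})

  ◅-congˡ : ∀ {u v w} {e f : Edge K u v} (p : EdgePath K v w) →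
            (e ◅ ε) ≈ (f ◅ ε) → (e ◅ p) ≈ (f ◅ p)
  ◅-congˡ p e≈f = ◅◅-cong e≈f (≃-refl {p = p})

  compose-◅ : ∀ {u v w x} (e : Edge K u v) (f : Edge K v w) (g : Edge K u w)
              (p : EdgePath K w x) → (e ◅ f ◅ p) ≈ (g ◅ p)
  compose-◅ e f g p = ◅◅-cong (compose e f g) (≃-refl {p = p})

  loop-◅ : ∀ {u v} (e : Edge K u u) (p : EdgePath K u v) → (e ◅ p) ≈ p
  loop-◅ e p = ◅◅-cong (degenerate e) (≃-refl {p = p})

  -- Edges carry clique proofs that need not be equal; the degenerate triangle on u, v, v identifies
  -- them up to homotopy.
  edge-irrelevant : ∀ {u v} (e f : Edge K u v) → (e ◅ ε) ≈ (f ◅ ε)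
  edge-irrelevant {v = v} e f =
    ≃-trans (◅-congʳ e (≃-sym (degenerate loop))) (compose e loop f)
    where
    loop : Edge K v v
    loop = edge (contradiction refl)

  -- Ascending paths for an orientation with a single maximal vertex.

  module _
    (_⊏_ : Vertex → Vertex → Set)
    (⊏⇒Adj : ∀ {u v} → u ⊏ v → Adj u v)
    (orient : ∀ {u v} → Adj u v → u ⊏ v ⊎ v ⊏ u)
    (⊐-wellFounded : WellFounded (flip _⊏_))
    (top : Vertex)
    (top-maximal : ∀ {u} → ¬ (top ⊏ u))
    (top⊎ascend : ∀ u → u ≡ top ⊎ ∃[ v ] u ⊏ v)
    where

    LinkEdge : Vertex → Vertex → Vertex → Set
    LinkEdge u v w = u ⊏ v × u ⊏ w × Edge K v w

    Ascent : Vertex → Set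
    Ascent u = Star _⊏_ u top

    ⊏⇒Edge : ∀ {u v} → u ⊏ v → Edge K u v
    ⊏⇒Edge u⊏v = edge λ _ → ⊏⇒Adj u⊏v

    path : ∀ {u v} → Star _⊏_ u v → EdgePath K u v
    path = Star.map ⊏⇒Edge

    ascent : ∀ u → Ascent u
    ascent u = go (⊐-wellFounded u)
      where
      go : ∀ {u} → Acc (flip _⊏_) u → Ascent u
      go {u} (acc rs) with top⊎ascend u
      ... | inj₁ refl      = ε
      ... | inj₂ (_ , u⊏v) = u⊏v ◅ go (rs u⊏v)

    AscentsHomotopic : Vertex → Set
    AscentsHomotopic u = (p q : Ascent u) → path p ≈ path q

    edge-ascent : ∀ {u v} → AscentsHomotopic u → AscentsHomotopic v →
                  (e : Edge K u v) (p : Ascent u) (q : Ascent v) →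
                  (e ◅ path q) ≈ path p
    edge-ascent {u} {v} hu hv e p q with u ≟ᵥ v
    ... | yes refl = ≃-trans (loop-◅ e (path q)) (hu q p)
    ... | no u≢v with orient (near e u≢v)
    ...   | inj₁ u⊏v =
      ≃-trans (◅-congˡ (path q) (edge-irrelevant e (⊏⇒Edge u⊏v)))
              (hu (u⊏v ◅ q) p)
    -- On a descending edge, q may be exchanged for the ascent that first returns to u; the
    -- resulting backtrack contracts.
    ...   | inj₂ v⊏u =
      ≃-trans (◅-congʳ e (hv q (v⊏u ◅ p)))
      (≃-trans (compose-◅ e (⊏⇒Edge v⊏u) loop (path p))
               (loop-◅ loop (path p)))
      where
      loop : Edge K u u
      loop = edge (contradiction refl)

    module _
      (link-connected : ∀ {u v w} → u ⊏ v → u ⊏ w → Star (LinkEdge u) v w)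
      where

      ascents-homotopic : ∀ u → AscentsHomotopic u
      ascents-homotopic u = go (⊐-wellFounded u)
        where
        -- Moves the first edge through the upper link of u one triangle at a time. Each
        -- intermediate vertex x gets an arbitrary ascent, compared with the previous one by the
        -- induction hypothesis h.
        along : ∀ {u v w} → (∀ {x} → u ⊏ x → AscentsHomotopic x) →
                (u⊏v : u ⊏ v) (p : Ascent v) (u⊏w : u ⊏ w) (q : Ascent w) →
                Star (LinkEdge u) v w → path (u⊏v ◅ p) ≈ path (u⊏w ◅ q)
        along h u⊏v p u⊏w q ε =
          ◅◅-cong (edge-irrelevant (⊏⇒Edge u⊏v) (⊏⇒Edge u⊏w)) (h u⊏v p q)
        along h u⊏v p u⊏w q (_◅_ {j = x} (_ , u⊏x , e) es) =
          ≃-trans (◅-congʳ (⊏⇒Edge u⊏v)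
                    (≃-sym (edge-ascent (h u⊏v) (h u⊏x) e p r)))
          (≃-trans (compose-◅ (⊏⇒Edge u⊏v) e (⊏⇒Edge u⊏x) (path r))
                   (along h u⊏x r u⊏w q es))
          where
          r : Ascent x
          r = ascent x

        go : ∀ {u} → Acc (flip _⊏_) u → AscentsHomotopic u
        go _        ε         ε         = ≃-refl
        go _        ε         (t⊏v ◅ _) = contradiction t⊏v top-maximal
        go _        (t⊏v ◅ _) ε         = contradiction t⊏v top-maximal
        go (acc rs) (u⊏v ◅ p) (u⊏w ◅ q) =
          along (λ u⊏x → go (rs u⊏x)) u⊏v p u⊏w q (link-connected u⊏v u⊏w)

      path-ascent : ∀ {u v} (p : EdgePath K u v) →
                    (p ◅◅ path (ascent v)) ≈ path (ascent u)
      path-ascent ε = ≃-refl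
      path-ascent {u} (_◅_ {j = v} e p) =
        ≃-trans (◅-congʳ e (path-ascent p))
                (edge-ascent (ascents-homotopic u) (ascents-homotopic v) e
                             (ascent u) (ascent v))

      simplyConnected : SimplyConnected K
      simplyConnected = record
        { inhabited = top
        ; connected = λ u v →
            path (ascent u) ◅◅ reversePath K (path (ascent v))
        ; trivial   = trivial-at
        }
        where
        trivial-at : ∀ v → IsTrivial (edgePathGroup K v)
        -- As c is not a loop, it cannot be cancelled in the group at v; appending its reverse gives
        -- a loop that p fixes, hence p is trivial.
        trivial-at v p = identityˡ-unique p (c ◅◅ c⁻¹)
          (subst (_≈ (c ◅◅ c⁻¹)) (◅◅-assoc p c c⁻¹)
            (◅◅-cong (path-ascent p) (≃-refl {p = c⁻¹})))
          where
          open GroupProperties (edgePathGroup K v) using (identityˡ-unique)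

          c : EdgePath K v top
          c = path (ascent v)

          c⁻¹ : EdgePath K top v
          c⁻¹ = reversePath K c

-- Row lengths up to permutation and empty rows.

nonzero : List ℕ → List ℕ
nonzero = filter (0 <?_)

nonzero-parts : ∀ {n} (α : Partition n) → nonzero (parts α) ≡ parts α
nonzero-parts α = filter-all (0 <?_) (positive α)

nonzero-∷ʳ-0 : ∀ xs → nonzero (xs ∷ʳ 0) ≡ nonzero xs
nonzero-∷ʳ-0 xs =
  trans (filter-++ (0 <?_) xs (0 ∷ [])) (++-identityʳ (nonzero xs))

nonzero-∷-cong : ∀ x {xs ys} → nonzero xs ≡ nonzero ys →
                 nonzero (x ∷ xs) ≡ nonzero (x ∷ ys)
nonzero-∷-cong zero    eq = eq
nonzero-∷-cong (suc x) eq = cong (suc x ∷_) eq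

sum-nonzero : ∀ xs → sum (nonzero xs) ≡ sum xs
sum-nonzero []           = refl
sum-nonzero (zero ∷ xs)  = sum-nonzero xs
sum-nonzero (suc x ∷ xs) = cong (suc x +_) (sum-nonzero xs)

-- Compares two ways of singling out a row: either y is found at the head x, or it lies in xs and
-- removing both rows leaves the same remainder zs.
∷-↭-∷ : ∀ {A : Set} {x y : A} {xs ys} → x ∷ xs ↭ y ∷ ys →
        (x ≡ y × xs ↭ ys) ⊎ ∃[ zs ] (xs ↭ y ∷ zs × ys ↭ x ∷ zs)
∷-↭-∷ {x = x} {y} xs↭ys with ∈-resp-↭ (↭-sym xs↭ys) (here refl)
... | here refl  = inj₁ (refl , drop-∷ xs↭ys)
... | there y∈xs with as , bs , refl ← ∈-∃++ y∈xs =
  inj₂ (as ++ bs , shift y as bs ,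
    drop-∷ (↭-trans (↭-sym xs↭ys)
      (↭-trans (prep x (shift y as bs)) (swap x y ↭-refl))))

≥-decTotalOrder : DecTotalOrder _ _ _
≥-decTotalOrder = Flip.decTotalOrder ≤-decTotalOrder

open Sort ≥-decTotalOrder using (sort; sort-↭; sort-↗)

parts-↭⇒≡ : ∀ {n} {α β : Partition n} → parts α ↭ parts β → α ≡ β
parts-↭⇒≡ {α = α} {β} α↭β = parts-injective (Pointwise-≡⇒≡
  (↗↭↗⇒≋ (DecTotalOrder.totalOrder ≥-decTotalOrder)
    (decreasing α) (decreasing β) (↭⇒↭ₛ α↭β)))

_≟ₚ_ : ∀ {n} → DecidableEquality (Partition n)
α ≟ₚ β = map′ parts-injective (cong parts) (≡-dec _≟_ (parts α) (parts β))

fromRows : ∀ {n} xs → sum xs ≡ n → ∃[ α ] parts {n} α ↭ nonzero xs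
fromRows xs sum≡n = mkPartition (sort (nonzero xs)) (sort-↗ (nonzero xs))
  (All-resp-↭ (↭-sym (sort-↭ (nonzero xs))) (all-filter (0 <?_) xs))
  (trans (sum-↭ (sort-↭ (nonzero xs))) (trans (sum-nonzero xs) sum≡n))
  , sort-↭ (nonzero xs)

↝⇒parts-↭ : ∀ {n} {α β : Partition n} → α ↝ β → ∃[ a ] ∃[ b ] ∃[ others ]
  (parts α ↭ nonzero (suc a ∷ b ∷ others) ×
   parts β ↭ nonzero (a ∷ suc b ∷ others))
↝⇒parts-↭ {α = α} (a , b , others , α↭ , β↭) = a , b , others ,
  ↭-trans (↭-reflexive (sym (trans (nonzero-∷ʳ-0 (parts α)) (nonzero-parts α))))
          (filter-↭ (0 <?_) α↭) ,
  β↭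

-- `rows` supplies exactly one empty row. It is the target if b is 0; otherwise it joins the
-- remaining rows, whose own zeros are dropped first.
parts-↭⇒↝ : ∀ {n} {α β : Partition n} a b others →
  parts α ↭ nonzero (suc a ∷ b ∷ others) →
  parts β ↭ nonzero (a ∷ suc b ∷ others) → α ↝ β
parts-↭⇒↝ a zero others α↭ β↭ = a , 0 , nonzero others ,
  ↭-trans (++⁺ʳ (0 ∷ []) α↭)
    (prep (suc a) (↭-trans (shift 0 (nonzero others) [])
      (prep 0 (↭-reflexive (++-identityʳ (nonzero others)))))) ,
  ↭-trans β↭ (↭-reflexive (nonzero-∷-cong a (cong (1 ∷_)
    (sym (filter-idem (0 <?_) others)))))
parts-↭⇒↝ a (suc b) others α↭ β↭ = a , suc b , nonzero others ∷ʳ 0 ,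
  ++⁺ʳ (0 ∷ []) α↭ ,
  ↭-trans β↭ (↭-reflexive (nonzero-∷-cong a (cong (suc (suc b) ∷_)
    (sym (trans (nonzero-∷ʳ-0 (nonzero others))
                (filter-idem (0 <?_) others))))))

-- The ascending orientation and the sum of squares.

infix 4 _⊏_
-- An ascending move never enters the empty row, so the target has length `suc b` and `others`
-- consists of parts of α; `nonzero` can only delete the source row, when a is 0.
_⊏_ : ∀ {n} → Partition n → Partition n → Set
α ⊏ β = ∃[ a ] ∃[ b ] ∃[ others ]
  (parts α ↭ suc a ∷ suc b ∷ others × a ≤ b ×
   parts β ↭ nonzero (a ∷ suc (suc b) ∷ others))

sumSquares : List ℕ → ℕ
sumSquares xs = sum (map (λ x → x * x) xs)

sumSquares-↭ : ∀ {xs ys} → xs ↭ ys → sumSquares xs ≡ sumSquares ys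
sumSquares-↭ xs↭ys = sum-↭ (map⁺ (λ x → x * x) xs↭ys)

sumSquares-nonzero : ∀ xs → sumSquares (nonzero xs) ≡ sumSquares xs
sumSquares-nonzero []           = refl
sumSquares-nonzero (zero ∷ xs)  = sumSquares-nonzero xs
sumSquares-nonzero (suc x ∷ xs) =
  cong (suc x * suc x +_) (sumSquares-nonzero xs)

sumSquares≤sum² : ∀ xs → sumSquares xs ≤ sum xs * sum xs
sumSquares≤sum² []       = ≤-refl
sumSquares≤sum² (x ∷ xs) = begin
  x * x + sumSquares xs            ≤⟨ +-monoʳ-≤ (x * x) (sumSquares≤sum² xs) ⟩
  x * x + sum xs * sum xs          ≤⟨ m≤m+n _ _ ⟩
  x * x + sum xs * sum xs + 2 * (x * sum xs)
                                   ≡⟨ square x (sum xs) ⟩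
  (x + sum xs) * (x + sum xs)      ∎
  where
  open ≤-Reasoning

  square : ∀ x s → x * x + s * s + 2 * (x * s) ≡ (x + s) * (x + s)
  square = solve-∀

sumSquares-transfer : ∀ {a b} xs → a ≤ b →
  sumSquares (suc a ∷ suc b ∷ xs) < sumSquares (a ∷ suc (suc b) ∷ xs)
sumSquares-transfer {a} xs a≤b with c , refl ← m≤n⇒∃[o]m+o≡n a≤b =
  -- With b = a + c the sum of squares grows by 2c + 2; one unit gives strictness and the other 2c +
  -- 1 are discarded.
  m+n≤o⇒m≤o _ (≤-reflexive (gain a c (sumSquares xs)))
  where
  gain : ∀ a c s →
    suc (suc a * suc a + (suc (a + c) * suc (a + c) + s)) + suc (2 * c) ≡
    a * a + (suc (suc (a + c)) * suc (suc (a + c)) + s)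
  gain = solve-∀

⊏⇒sumSquares< : ∀ {n} {α β : Partition n} → α ⊏ β →
                sumSquares (parts α) < sumSquares (parts β)
⊏⇒sumSquares< (a , b , others , α↭ , a≤b , β↭) = subst₂ _<_
  (sym (sumSquares-↭ α↭))
  (sym (trans (sumSquares-↭ β↭)
              (sumSquares-nonzero (a ∷ suc (suc b) ∷ others))))
  (sumSquares-transfer others a≤b)

-- The sum of squares increases along ascending moves and is bounded by the square of n, so
-- truncated subtraction from that bound strictly decreases.
⊐-wellFounded : ∀ {n} → WellFounded (flip (_⊏_ {n}))
⊐-wellFounded {n} = Subrelation.wellFounded (λ {α} {β} → deficit-< {α} {β})
  (On.wellFounded deficit <-wellFounded)
  where
  deficit : Partition n → ℕ
  deficit α = n * n ∸ sumSquares (parts α)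

  deficit-< : ∀ {α β} → β ⊏ α → deficit α < deficit β
  deficit-< {α} {β} β⊏α = ∸-monoʳ-< (⊏⇒sumSquares< {α = β} {α} β⊏α)
    (subst (λ m → sumSquares (parts α) ≤ m * m) (sum≡n α)
           (sumSquares≤sum² (parts α)))

parts-↭⇒parts-↭-nonzero : ∀ {n} {α : Partition n} {xs} →
                          parts α ↭ xs → parts α ↭ nonzero xs
parts-↭⇒parts-↭-nonzero {α = α} α↭ =
  ↭-trans (↭-reflexive (sym (nonzero-parts α))) (filter-↭ (0 <?_) α↭)

⊏⇒Adj : ∀ {n} (α β : Partition n) → α ⊏ β →
        SimpleGraph.Adj (partitionGraph n) α β
⊏⇒Adj α β α⊏β@(a , b , others , α↭ , _ , β↭) =
  (λ { refl → <-irrefl refl (⊏⇒sumSquares< {α = α} {α} α⊏β) }) ,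
  inj₁ (parts-↭⇒↝ {α = α} {β} a (suc b) others
    (parts-↭⇒parts-↭-nonzero {α = α} α↭) β↭)

-- If a < b, the target is already at least as long as the source. If b < a, the reverse move, from
-- a row of length 1 + b to one of length a, ascends.
↝⇒⊏⊎⊐ : ∀ {n} (α β : Partition n) → α ≢ β → α ↝ β → α ⊏ β ⊎ β ⊏ α
↝⇒⊏⊎⊐ α β α≢β α↝β with ↝⇒parts-↭ {α = α} {β} α↝β
... | a , b , others , α↭ , β↭ with compare a b
...   | less a k =
  inj₁ (a , a + k , nonzero others , α↭ , m≤m+n a k ,
    ↭-trans β↭ (↭-reflexive (nonzero-∷-cong a (cong (suc (suc (a + k)) ∷_)
      (sym (filter-idem (0 <?_) others))))))
-- The move only exchanges two rows.
...   | equal a = contradiction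
  (parts-↭⇒≡ {α = α} {β} (↭-trans α↭ (↭-trans
    (filter-↭ (0 <?_) (swap (suc a) a (↭-refl {x = others}))) (↭-sym β↭))))
  α≢β
...   | greater b k =
  inj₂ (b , b + k , nonzero others ,
    ↭-trans β↭ (swap (suc (b + k)) (suc b) ↭-refl) , m≤m+n b k ,
    ↭-trans α↭ (↭-trans
      (filter-↭ (0 <?_) (swap (suc (suc (b + k))) b (↭-refl {x = others})))
      (↭-reflexive (nonzero-∷-cong b (cong (suc (suc (b + k)) ∷_)
        (sym (filter-idem (0 <?_) others)))))))

orient : ∀ {n} (α β : Partition n) →
         SimpleGraph.Adj (partitionGraph n) α β → α ⊏ β ⊎ β ⊏ α
orient α β (α≢β , inj₁ α↝β) = ↝⇒⊏⊎⊐ α β α≢β α↝β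
orient α β (α≢β , inj₂ β↝α) = swap⊎ (↝⇒⊏⊎⊐ β α (α≢β ∘ sym) β↝α)

oneRow : ∀ {n} → n ≥ 1 → Partition n
oneRow {n} n≥1 = mkPartition (n ∷ []) [-] (n≥1 ∷ []) (+-identityʳ n)

-- An ascending move involves two nonempty rows.
oneRow-maximal : ∀ {n} (n≥1 : n ≥ 1) {α} → ¬ (oneRow n≥1 ⊏ α)
oneRow-maximal n≥1 (a , b , others , n↭ , _) with () ← ↭-length n↭

-- Connectedness of upper links.

module _ {n : ℕ} where
  open AscendingPaths (partitionGraph n) _≟ₚ_ using (Near; edge)

  LinkPath : Partition n → Partition n → Partition n → Set
  LinkPath α = Star λ β γ →
    α ⊏ β × α ⊏ γ × Edge (cliqueComplex (partitionGraph n)) β γ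

  parts-↭⇒Near : (α β : Partition n) → ∀ a b others →
    parts α ↭ nonzero (suc a ∷ b ∷ others) →
    parts β ↭ nonzero (a ∷ suc b ∷ others) → Near α β
  parts-↭⇒Near α β a b others α↭ β↭ α≢β =
    α≢β , inj₁ (parts-↭⇒↝ {α = α} {β} a b others α↭ β↭)

  module UpperLink (α : Partition n) (m : ℕ) (tail : List ℕ)
    (α≡ : parts α ≡ suc m ∷ tail) where

    -- The target is the first row, which is a longest one. These neighbours are pairwise near and
    -- every upper neighbour is near one of them.
    MoveToTop : Partition n → Set
    MoveToTop β = ∃[ a ] ∃[ others ]
      (tail ↭ suc a ∷ others × parts β ↭ nonzero (a ∷ suc (suc m) ∷ others))

    tail↭⇒parts↭ : ∀ {a others} → tail ↭ suc a ∷ others →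
                   parts α ↭ suc a ∷ suc m ∷ others
    tail↭⇒parts↭ {a} tail↭ = ↭-trans (↭-reflexive α≡)
      (↭-trans (prep (suc m) tail↭) (swap (suc m) (suc a) ↭-refl))

    moveToTop : ∀ {a others} → tail ↭ suc a ∷ others → ∃[ β ] MoveToTop β
    moveToTop {a} {others} tail↭ =
      let β , β↭ = fromRows (a ∷ suc (suc m) ∷ others)
            (trans (+-suc a (suc m + sum others))
              (trans (sym (sum-↭ (tail↭⇒parts↭ tail↭))) (sum≡n α)))
      in β , a , others , tail↭ , β↭

    tail≤top : All (_≤ suc m) tail
    tail≤top with ps ∷ _ ← Linked⇒AllPairs (flip ≤-trans)
      (subst (Linked _≥_) α≡ (decreasing α)) = ps

    moveToTop⇒⊏ : ∀ β → MoveToTop β → α ⊏ β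
    moveToTop⇒⊏ β (a , others , tail↭ , β↭)
      with a<m ∷ _ ← All-resp-↭ tail↭ tail≤top =
      a , m , others , tail↭⇒parts↭ tail↭ , s≤s⁻¹ a<m , β↭

    ⊏⇒near-moveToTop : ∀ β → α ⊏ β → ∃[ γ ] (MoveToTop γ × Near β γ)
    ⊏⇒near-moveToTop β (a , b , others , α↭ , a≤b , β↭)
      with ∷-↭-∷ (↭-trans (↭-reflexive (sym α≡)) α↭)
    -- The source is the first row. The target, being no shorter, has the same length, so exchanging
    -- the two rows turns the move into one to the first row.
    ... | inj₁ (refl , tail↭) with b≤m ∷ _ ← All-resp-↭ tail↭ tail≤top
      with refl ← ≤-antisym a≤b (s≤s⁻¹ b≤m) =
      β , (a , others , tail↭ , β↭) , contradiction refl
    ... | inj₂ (zs , tail↭ , others↭) with ∷-↭-∷ others↭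
    ...   | inj₁ (refl , others↭zs) =
      β , (a , others ,
           ↭-trans tail↭ (prep (suc a) (↭-sym others↭zs)) , β↭) ,
      contradiction refl
    -- The first row is neither source nor target. Keeping the source and redirecting the cell gives
    -- γ, reached from β by moving a cell from the old target, now of length b + 2, to the first
    -- row.
    ...   | inj₂ (ws , others↭ws , zs↭) =
      let γ , γ-move@(_ , _ , _ , γ↭) =
            moveToTop (↭-trans tail↭ (prep (suc a) zs↭)) in
      γ , γ-move ,
      parts-↭⇒Near β γ (suc b) (suc m) (a ∷ ws)
        (↭-trans β↭ (filter-↭ (0 <?_) (↭-trans
          (prep a (prep (suc (suc b)) others↭ws))
          (↭-trans (swap a (suc (suc b)) ↭-refl)
                   (prep (suc (suc b)) (swap a (suc m) ↭-refl))))))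
        (↭-trans γ↭ (filter-↭ (0 <?_)
          (↭-trans (↭-sym (shift a (suc (suc m) ∷ suc b ∷ []) ws))
                   (swap (suc (suc m)) (suc b) ↭-refl))))

    moveToTop-near : ∀ β γ → MoveToTop β → MoveToTop γ → Near β γ
    moveToTop-near β γ (a , os , tail↭ , β↭) (b , os′ , tail↭′ , γ↭)
      with ∷-↭-∷ (↭-trans (↭-sym tail↭) tail↭′)
    ... | inj₁ (refl , os↭os′) = contradiction
      (parts-↭⇒≡ {α = β} {γ} (↭-trans β↭ (↭-trans
        (filter-↭ (0 <?_) (prep a (prep (suc (suc m)) os↭os′))) (↭-sym γ↭))))
    -- The sources are different rows: returning a cell to the source of β from that of γ turns β
    -- into γ.
    ... | inj₂ (zs , os↭ , os′↭) =
      parts-↭⇒Near β γ b a (suc (suc m) ∷ zs)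
        (↭-trans β↭ (filter-↭ (0 <?_) (↭-trans
          (prep a (prep (suc (suc m)) os↭))
          (shift (suc b) (a ∷ suc (suc m) ∷ []) zs))))
        (↭-trans γ↭ (filter-↭ (0 <?_) (prep b (↭-trans
          (prep (suc (suc m)) os′↭)
          (swap (suc (suc m)) (suc a) ↭-refl)))))

    link-connected : ∀ {β γ} → α ⊏ β → α ⊏ γ → LinkPath α β γ
    link-connected {β} {γ} α⊏β α⊏γ =
      let β′ , mβ , ββ′ = ⊏⇒near-moveToTop β α⊏β
          γ′ , mγ , γγ′ = ⊏⇒near-moveToTop γ α⊏γ
          α⊏β′ = moveToTop⇒⊏ β′ mβ
          α⊏γ′ = moveToTop⇒⊏ γ′ mγ
      in (α⊏β , α⊏β′ , edge ββ′) ◅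
         (α⊏β′ , α⊏γ′ , edge (moveToTop-near β′ γ′ mβ mγ)) ◅
         (α⊏γ′ , α⊏γ , reverseEdge (cliqueComplex (partitionGraph n)) (edge γγ′)) ◅ ε

  oneRow⊎ascend : (n≥1 : n ≥ 1) (α : Partition n) →
                  α ≡ oneRow n≥1 ⊎ ∃[ β ] α ⊏ β
  oneRow⊎ascend n≥1 α = go (parts α) refl (positive α) (sum≡n α)
    where
    go : ∀ ps → parts α ≡ ps → All (0 <_) ps → sum ps ≡ n →
         α ≡ oneRow n≥1 ⊎ ∃[ β ] α ⊏ β
    go []       _  _ refl  = contradiction n≥1 λ ()
    go (x ∷ []) α≡ _ x+0≡n = inj₁ (parts-injective
      (trans α≡ (cong (_∷ []) (trans (sym (+-identityʳ x)) x+0≡n))))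
    go (zero ∷ _ ∷ _)          _  (() ∷ _)     _
    go (suc _ ∷ zero ∷ _)      _  (_ ∷ () ∷ _) _
    -- With two parts, the second can give a cell to the first.
    go (suc m ∷ suc a ∷ tail) α≡ _            _ =
      let β , β-move = moveToTop ↭-refl in inj₂ (β , moveToTop⇒⊏ β β-move)
      where open UpperLink α m (suc a ∷ tail) α≡

  upperLink-connected : ∀ {α β γ} → α ⊏ β → α ⊏ γ → LinkPath α β γ
  upperLink-connected {α} {β} {γ} α⊏β@(_ , _ , _ , α↭ , _) α⊏γ =
    go (parts α) refl (positive α)
    where
    go : ∀ ps → parts α ≡ ps → All (0 <_) ps → LinkPath α β γ
    go []             α≡ _ with () ← ↭-length (subst (_↭ _) α≡ α↭)
    go (zero ∷ _)     _  (() ∷ _)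
    go (suc m ∷ tail) α≡ _ =
      UpperLink.link-connected α m tail α≡ {β} {γ} α⊏β α⊏γ

theorem6p7 : (n : ℕ) → n ≥ 1 → SimplyConnected (cliqueComplex (partitionGraph n))
theorem6p7 n n≥1 = AscendingPaths.simplyConnected (partitionGraph n) _≟ₚ_
  _⊏_ (λ {α} {β} → ⊏⇒Adj α β) (λ {α} {β} → orient α β) ⊐-wellFounded
  (oneRow n≥1) (λ {α} → oneRow-maximal n≥1 {α}) (oneRow⊎ascend n≥1)
  (λ {α} {β} {γ} → upperLink-connected {n} {α} {β} {γ})
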